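{- For any one-unambiguous regular expression $r$ over an alphabet $\Sigma$, a regular expression $s$ defining $\Sigma^*\setminus L(r)$ can be constructed in time $\mathcal{O}(n^3)$, where $n$ is the size of $r$.
   Context: $\Sigma$ denotes a finite alphabet. Regular expressions over $\Sigma$: $\emptyset$, $\varepsilon$, and every symbol $a\in\Sigma$ are regular expressions; if $r_1,r_2$ are regular expressions, then so are $r_1\cdot r_2$, $r_1+r_2$ and $r_1^*$. The language $L(r)$ is defined as usual; $r$ defines a language $L$ if $L(r)=L$. For a set $S=\{a_1,\dots,a_m\}\subseteq\Sigma$, the abbreviation $S$ stands for the regular expression $a_1+\cdots+a_m$. The size $|r|$ is the number of alphabet symbols and operators in $r$, disregarding parentheses: $|\emptyset|=|\varepsilon|=|a|=1$ for $a\in\Sigma$, $|r_1r_2|=|r_1+r_2|=|r_1|+|r_2|+1$, $|r^*|=|r|+1$. The marking $r^\flat$ of a regular expression $r$ is obtained by giving the different occurrences of alphabet symbols in $r$ distinct subscripts; e.g. the marking of $(a+b)^*a+bc$ is $(a_1+b_2)^*a_3+b_4c_5$. $\mathrm{Sym}(r^\flat)$ is the set of subscripted symbols occurring in $r^\flat$. For a marked symbol $x$, $x^\natural$ denotes the symbol of $\Sigma$ obtained by dropping the subscript. A regular expression $r$ is one-unambiguous iff for all strings $w,u,v\in\mathrm{Sym}(r^\flat)^*$ and all symbols $x,y\in\mathrm{Sym}(r^\flat)$, the conditions $uxv,uyw\in L(r^\flat)$ and $x\neq y$ imply $x^\natural\neq y^\natural$. (The constructed $s$ is an arbitrary regular expression,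 not required to be one-unambiguous.) -}

module Defs where

open import Data.Fin using (Fin)
open import Data.List using (List; []; _∷_; [_]; _++_; length)
open import Data.List.Membership.Propositional using (_∈_)
open import Data.List.Relation.Unary.All using (All)
open import Data.Nat using (ℕ; zero; suc; _+_)
open import Data.Product using (_×_; _,_; proj₁)
open import Data.Vec using (Vec; lookup) renaming ([] to []ᵛ; _∷_ to _∷ᵛ_)
open import Level using (0ℓ)
open import Relation.Binary.PropositionalEquality using (_≡_; _≢_)
open import Relation.Nullary using (¬_)
open import Relation.Unary using (Pred)

infixl 6 _⊕_
infixl 7 _·_
infix  8 _⋆

data Regexp (A : Set) : Set where
  ∅ ε     : Regexp A
  sym     : A → Regexp A
  _·_ _⊕_ : Regexp A → Regexp A → Regexp A
  _⋆      : Regexp A → Regexp A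

data L {A : Set} : Regexp A → Pred (List A) 0ℓ where
  empty  : L ε []
  symbol : ∀ {a} → L (sym a) [ a ]
  concat : ∀ {r₁ r₂ u v} → L r₁ u → L r₂ v → L (r₁ · r₂) (u ++ v)
  left   : ∀ {r₁ r₂ w} → L r₁ w → L (r₁ ⊕ r₂) w
  right  : ∀ {r₁ r₂ w} → L r₂ w → L (r₁ ⊕ r₂) w
  done   : ∀ {r} → L (r ⋆) []
  more   : ∀ {r u v} → L r u → L (r ⋆) v → L (r ⋆) (u ++ v)

size : ∀ {A} → Regexp A → ℕ
size ∅         = 1
size ε         = 1
size (sym _)   = 1
size (r₁ · r₂) = size r₁ + size r₂ + 1
size (r₁ ⊕ r₂) = size r₁ + size r₂ + 1
size (r ⋆)     = size r + 1

Sym : ∀ {A} → Regexp A → List A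
Sym ∅         = []
Sym ε         = []
Sym (sym a)   = [ a ]
Sym (r₁ · r₂) = Sym r₁ ++ Sym r₂
Sym (r₁ ⊕ r₂) = Sym r₁ ++ Sym r₂
Sym (r ⋆)     = Sym r

-- Occurrences are numbered from left to right; i is the first subscript used.
markFrom : ∀ {A} → ℕ → Regexp A → Regexp (A × ℕ)
markFrom i ∅         = ∅
markFrom i ε         = ε
markFrom i (sym a)   = sym (a , i)
markFrom i (r₁ · r₂) = markFrom i r₁ · markFrom (i + length (Sym r₁)) r₂
markFrom i (r₁ ⊕ r₂) = markFrom i r₁ ⊕ markFrom (i + length (Sym r₁)) r₂
markFrom i (r ⋆)     = markFrom i r ⋆

infix 9 _♭ _♮

_♭ : ∀ {A} → Regexp A → Regexp (A × ℕ)
r ♭ = markFrom 1 r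

_♮ : ∀ {A : Set} → A × ℕ → A
_♮ = proj₁

OneUnambiguous : ∀ {A} → Regexp A → Set
OneUnambiguous r =
  ∀ {w u v x y} →
  All (_∈ Sym (r ♭)) w → All (_∈ Sym (r ♭)) u → All (_∈ Sym (r ♭)) v →
  x ∈ Sym (r ♭) → y ∈ Sym (r ♭) →
  L (r ♭) (u ++ x ∷ v) → L (r ♭) (u ++ y ∷ w) →
  x ≢ y → x ♮ ≢ y ♮

-- Expressions are given to, and returned by, an algorithm as words over a
-- finite alphabet, in Polish notation: it needs no parentheses, and the word
-- written for r has exactly `size r` letters.
data Token (A : Set) : Set where
  ‵∅ ‵ε ‵· ‵⊕ ‵⋆ : Token A
  ‵sym           : A → Token A

polish : ∀ {A} → Regexp A → List (Token A)
polish ∅         = [ ‵∅ ]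
polish ε         = [ ‵ε ]
polish (sym a)   = [ ‵sym a ]
polish (r₁ · r₂) = ‵· ∷ polish r₁ ++ polish r₂
polish (r₁ ⊕ r₂) = ‵⊕ ∷ polish r₁ ++ polish r₂
polish (r ⋆)     = ‵⋆ ∷ polish r

-- The model of computation is pure first-order LISP: recursive functions over
-- binary trees with atoms at the leaves, evaluated call-by-value at unit cost
-- per evaluation step.  A program is a fixed finite object and every step
-- allocates at most one cell, reads one cell, compares two atoms or transfers
-- control, so that a step takes constant time on a random access machine.
-- There is no arithmetic, hence no cost hidden in the size of numbers.
-- Trees may share subtrees, but a list of atoms of length ℓ that is written
-- out takes ℓ cells; this is why results are read off as words.
data Value (A : Set) : Set where
  nil  : Value A
  atom : A → Value A
  cons : Value A → Value A → Value A

list : ∀ {A} → List A → Value A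
list []       = nil
list (a ∷ as) = cons (atom a) (list as)

head tail : ∀ {A} → Value A → Value A
head (cons v _) = v
head _         = nil
tail (cons _ v) = v
tail _         = nil

data IsCons {A : Set} : Value A → Set where
  cons : ∀ {v w} → IsCons (cons v w)

data SameAtom {A : Set} : Value A → Value A → Set where
  nil  : SameAtom nil nil
  atom : ∀ {a} → SameAtom (atom a) (atom a)

-- `Expr A m n`: m function names, n variables in scope (de Bruijn indices).
-- Functions are unary; several arguments are passed as one tree.
data Expr (A : Set) (m : ℕ) : ℕ → Set where
  var    : ∀ {n} → Fin n → Expr A m n
  nil    : ∀ {n} → Expr A m n
  atom   : ∀ {n} → A → Expr A m n
  cons   : ∀ {n} → Expr A m n → Expr A m n → Expr A m n
  car    : ∀ {n} → Expr A m n → Expr A m n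
  cdr    : ∀ {n} → Expr A m n → Expr A m n
  ifCons : ∀ {n} (e e₁ e₂ : Expr A m n) → Expr A m n
  ifEq   : ∀ {n} (e e′ e₁ e₂ : Expr A m n) → Expr A m n
  let′   : ∀ {n} → Expr A m n → Expr A m (suc n) → Expr A m n
  call   : ∀ {n} → Fin m → Expr A m n → Expr A m n

record Program (A : Set) : Set where
  field
    functions : ℕ
    body      : Fin functions → Expr A functions 1
    main      : Expr A functions 1

-- `Eval body ρ e v t`: in the environment ρ, e evaluates to v in t steps.
data Eval {A : Set} {m : ℕ} (body : Fin m → Expr A m 1) :
          ∀ {n} → Vec (Value A) n → Expr A m n → Value A → ℕ → Set where
  var : ∀ {n} {ρ : Vec _ n} {i} → Eval body ρ (var i) (lookup ρ i) 1
  nil : ∀ {n} {ρ : Vec _ n} → Eval body ρ nil nil 1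
  atom : ∀ {n} {ρ : Vec _ n} {a} → Eval body ρ (atom a) (atom a) 1
  cons : ∀ {n} {ρ : Vec _ n} {e₁ e₂ v₁ v₂ t₁ t₂} →
         Eval body ρ e₁ v₁ t₁ → Eval body ρ e₂ v₂ t₂ →
         Eval body ρ (cons e₁ e₂) (cons v₁ v₂) (suc (t₁ + t₂))
  car : ∀ {n} {ρ : Vec _ n} {e v t} →
        Eval body ρ e v t → Eval body ρ (car e) (head v) (suc t)
  cdr : ∀ {n} {ρ : Vec _ n} {e v t} →
        Eval body ρ e v t → Eval body ρ (cdr e) (tail v) (suc t)
  ifCons-yes : ∀ {n} {ρ : Vec _ n} {e e₁ e₂ v w t t₁} →
               Eval body ρ e v t → IsCons v → Eval body ρ e₁ w t₁ →
               Eval body ρ (ifCons e e₁ e₂) w (suc (t + t₁))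
  ifCons-no : ∀ {n} {ρ : Vec _ n} {e e₁ e₂ v w t t₂} →
              Eval body ρ e v t → ¬ IsCons v → Eval body ρ e₂ w t₂ →
              Eval body ρ (ifCons e e₁ e₂) w (suc (t + t₂))
  ifEq-yes : ∀ {n} {ρ : Vec _ n} {e e′ e₁ e₂ v v′ w t t′ t₁} →
             Eval body ρ e v t → Eval body ρ e′ v′ t′ →
             SameAtom v v′ → Eval body ρ e₁ w t₁ →
             Eval body ρ (ifEq e e′ e₁ e₂) w (suc (t + t′ + t₁))
  ifEq-no : ∀ {n} {ρ : Vec _ n} {e e′ e₁ e₂ v v′ w t t′ t₂} →
            Eval body ρ e v t → Eval body ρ e′ v′ t′ →
            ¬ SameAtom v v′ → Eval body ρ e₂ w t₂ →
            Eval body ρ (ifEq e e′ e₁ e₂) w (suc (t + t′ + t₂))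
  let′ : ∀ {n} {ρ : Vec _ n} {e e₁ v w t t₁} →
         Eval body ρ e v t → Eval body (v ∷ᵛ ρ) e₁ w t₁ →
         Eval body ρ (let′ e e₁) w (suc (t + t₁))
  call : ∀ {n} {ρ : Vec _ n} {f e v w t t₁} →
         Eval body ρ e v t → Eval body (v ∷ᵛ []ᵛ) (body f) w t₁ →
         Eval body ρ (call f e) w (suc (t + t₁))

_⟨_⟩↦_inTime_ : ∀ {A} → Program A → List A → List A → ℕ → Set
P ⟨ x ⟩↦ y inTime t = Eval body (list x ∷ᵛ []ᵛ) main (list y) t
  where open Program P

{-# OPTIONS --safe #-}

-- In a one-unambiguous expression, a prefix of a word of L(r) determines the
-- occurrence of r at which it ends.  A word outside L(r) is therefore either
-- rejected at its first letter (or empty), or it reaches an occurrence x and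
-- continues with a letter that cannot follow x, or ends there although x is not
-- final.  The words of the second kind that die inside a subexpression are
-- described by recursion on it, given the set C of letters that may follow it:
-- a dead word of r₁r₂ dies in r₁, or is a word of r₁ followed by a dead word of
-- r₂; a dead word of r⋆ is a word of r⋆ followed by a dead word of r.  Each node
-- contributes one copy of itself or of its left factor, so that the expression
-- has quadratic size and is written out in quadratic time.
module Submission where

open import Data.Bool using (Bool; true; false; T; T?; _∨_; if_then_else_)
open import Data.Bool.Properties using (T-∨)
open import Data.Empty using (⊥-elim)
open import Data.Fin using (Fin; zero; suc)
open import Data.Fin.Patterns using (0F; 1F; 2F; 3F; 4F; 5F; 6F; 7F)
open import Data.Fin.Properties using (_≟_)
open import Data.List using (List; []; _∷_; [_]; _++_; map; length)
open import Data.List.Membership.Propositional using (_∈_)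
open import Data.List.Membership.Propositional.Properties using (∈-++⁺ˡ; ∈-++⁺ʳ; ∈-++⁻; ∈-insert)
open import Data.List.Properties
  using (++-assoc; ++-identityʳ; map-++; ∷-injective; ∷-injectiveˡ; ∷-injectiveʳ; length-++)
open import Data.List.Relation.Unary.All as All using (All; []; _∷_)
import Data.List.Relation.Unary.All.Properties as All
open import Data.List.Relation.Unary.Any using (here)
open import Data.Nat using (ℕ; zero; suc; _+_; _*_; _^_; _≤_; _<_; z≤n; s≤s)
open import Data.Nat.Induction using (<-wellFounded)
open import Data.Nat.Properties hiding (_≟_)
import Data.Nat.Properties as ℕ
open import Data.Nat.Tactic.RingSolver using (solve-∀)
open import Data.Product using (Σ-syntax; ∃; ∃₂; ∃-syntax; _×_; _,_; proj₁; proj₂)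
open import Data.Product.Properties using (≡-dec)
open import Data.Sum using (_⊎_; inj₁; inj₂)
open import Data.Vec using (Vec; lookup) renaming ([] to []ᵛ; _∷_ to _∷ᵛ_)
open import Function using (_∘_; id)
open import Function.Bundles using (Equivalence)
open import Induction.WellFounded using (Acc; acc)
open import Relation.Binary.PropositionalEquality
  using (_≡_; _≢_; refl; cong; trans; subst)
  renaming (sym to sym-eq)
open import Relation.Nullary using (¬_; yes; no; contradiction; Reflects; ofʸ; ofⁿ)
open import Relation.Nullary.Decidable using (isYes; toWitness; fromWitness; decidable-stable)
open import Relation.Unary using (_≐_; ∁)
open import Defs

-- Words, languages and markings.

module _ {A : Set} where

  ·-split : ∀ {r₁ r₂ : Regexp A} {w} → L (r₁ · r₂) w →
            ∃₂ λ u v → w ≡ u ++ v × L r₁ u × L r₂ v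
  ·-split (concat p q) = _ , _ , refl , p , q

  ++-split : ∀ (u : List A) {v} p {x q} → u ++ v ≡ p ++ x ∷ q →
             (∃[ q₁ ] u ≡ p ++ x ∷ q₁ × q ≡ q₁ ++ v) ⊎
             (∃[ p₁ ] v ≡ p₁ ++ x ∷ q × p ≡ u ++ p₁)
  ++-split []      p       eq   = inj₂ (p , eq , refl)
  ++-split (_ ∷ u) []      refl = inj₁ (u , refl , refl)
  ++-split (_ ∷ u) (_ ∷ p) eq with ∷-injective eq
  ... | refl , eq′ with ++-split u p eq′
  ...   | inj₁ (q₁ , refl , e) = inj₁ (q₁ , refl , e)
  ...   | inj₂ (p₁ , e , refl) = inj₂ (p₁ , e , refl)

  -- The letter `x` lies in one of the iterations. No equation ties `p₁` to `p`: only what follows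
  -- `x` matters where this is used, and there every prefix is allowed.
  ⋆-split : ∀ {r : Regexp A} {w} p {x q} → L (r ⋆) w → w ≡ p ++ x ∷ q →
            ∃[ p₁ ] ∃[ q₁ ] ∃[ v ] L r (p₁ ++ x ∷ q₁) × q ≡ q₁ ++ v × L (r ⋆) v
  ⋆-split []      done ()
  ⋆-split (_ ∷ _) done ()
  ⋆-split p (more {u = u} d ds) eq with ++-split u p eq
  ... | inj₁ (q₁ , refl , e) = p , q₁ , _ , d , e , ds
  ... | inj₂ (p₁ , e , _)    = ⋆-split p₁ ds e

  L-Sym : ∀ {r : Regexp A} {w} → L r w → All (_∈ Sym r) w
  L-Sym empty                   = []
  L-Sym symbol                  = here refl ∷ []
  L-Sym (concat {r₁ = r₁} d d′) =
    All.++⁺ (All.map ∈-++⁺ˡ (L-Sym d)) (All.map (∈-++⁺ʳ (Sym r₁)) (L-Sym d′))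
  L-Sym (left d)                = All.map ∈-++⁺ˡ (L-Sym d)
  L-Sym (right {r₁ = r₁} d)     = All.map (∈-++⁺ʳ (Sym r₁)) (L-Sym d)
  L-Sym done                    = []
  L-Sym (more d d′)             = All.++⁺ (L-Sym d) (L-Sym d′)

  L-letter∈Sym : ∀ {r : Regexp A} p {x q} → L r (p ++ x ∷ q) → x ∈ Sym r
  L-letter∈Sym p d = All.lookup (L-Sym d) (∈-insert p)

  ⋆-snoc : ∀ {r : Regexp A} {u v} → L (r ⋆) u → L r v → L (r ⋆) (u ++ v)
  ⋆-snoc {v = v} done d = subst (L _) (++-identityʳ v) (more d done)
  ⋆-snoc {v = v} (more {u = u} {u′} d ds) e = subst (L _) (sym-eq (++-assoc u u′ v)) (more d (⋆-snoc ds e))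

  unmark : ∀ i (r : Regexp A) {z} → L (markFrom i r) z → L r (map _♮ z)
  unmark i ∅ ()
  unmark i ε empty = empty
  unmark i (sym a) symbol = symbol
  unmark i (r₁ · r₂) (concat {u = u} {v} d d′)
    rewrite map-++ _♮ u v = concat (unmark _ r₁ d) (unmark _ r₂ d′)
  unmark i (r₁ ⊕ r₂) (left d) = left (unmark _ r₁ d)
  unmark i (r₁ ⊕ r₂) (right d) = right (unmark _ r₂ d)
  unmark i (r ⋆) done = done
  unmark i (r ⋆) (more {u = u} {v} d d′)
    rewrite map-++ _♮ u v = more (unmark i r d) (unmark i (r ⋆) d′)

  mark : ∀ i (r : Regexp A) {w} → L r w → ∃[ z ] map _♮ z ≡ w × L (markFrom i r) z
  mark i ε empty = [] , refl , empty
  mark i (sym a) symbol = _ , refl , symbol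
  mark i (r₁ · r₂) (concat d d′)
    with mark i r₁ d | mark (i + length (Sym r₁)) r₂ d′
  ... | z , refl , e | z′ , refl , e′ = z ++ z′ , map-++ _♮ z z′ , concat e e′
  mark i (r₁ ⊕ r₂) (left d) with mark i r₁ d
  ... | z , eq , e = z , eq , left e
  mark i (r₁ ⊕ r₂) (right d) with mark (i + length (Sym r₁)) r₂ d
  ... | z , eq , e = z , eq , right e
  mark i (r ⋆) done = [] , refl , done
  mark i (r ⋆) (more d d′) with mark i r d | mark i (r ⋆) d′
  ... | z , refl , e | z′ , refl , e′ = z ++ z′ , map-++ _♮ z z′ , more e e′

  subscript-bounds-++ : ∀ i (r₁ r₂ : Regexp A) {x} →
    x ∈ Sym (markFrom i r₁) ++ Sym (markFrom (i + length (Sym r₁)) r₂) →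
    i ≤ proj₂ x × proj₂ x < i + length (Sym r₁ ++ Sym r₂)

  subscript-bounds : ∀ i (r : Regexp A) {x} → x ∈ Sym (markFrom i r) →
                     i ≤ proj₂ x × proj₂ x < i + length (Sym r)
  subscript-bounds i ∅ ()
  subscript-bounds i ε ()
  subscript-bounds i (sym a) (here refl) = ≤-refl , ≤-reflexive (+-comm 1 i)
  subscript-bounds i (r₁ · r₂) x∈ = subscript-bounds-++ i r₁ r₂ x∈
  subscript-bounds i (r₁ ⊕ r₂) x∈ = subscript-bounds-++ i r₁ r₂ x∈
  subscript-bounds i (r ⋆) x∈ = subscript-bounds i r x∈

  subscript-bounds-++ i r₁ r₂ x∈
    rewrite length-++ (Sym r₁) {Sym r₂} | sym-eq (+-assoc i (length (Sym r₁)) (length (Sym r₂)))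
    with ∈-++⁻ (Sym (markFrom i r₁)) x∈
  ... | inj₁ x∈₁ with subscript-bounds i r₁ x∈₁
  ...   | lo , hi = lo , <-≤-trans hi (m≤m+n _ _)
  subscript-bounds-++ i r₁ r₂ x∈ | inj₂ x∈₂ with subscript-bounds (i + length (Sym r₁)) r₂ x∈₂
  ...   | lo , hi = ≤-trans (m≤m+n i _) lo , hi

  -- The subscripts of `r₁` end below `i + length (Sym r₁)`, where those of `r₂` start.
  disjoint-Sym : ∀ i (r₁ r₂ : Regexp A) {x} → x ∈ Sym (markFrom i r₁) →
                 ¬ x ∈ Sym (markFrom (i + length (Sym r₁)) r₂)
  disjoint-Sym i r₁ r₂ x∈₁ x∈₂ =
    <⇒≱ (proj₂ (subscript-bounds i r₁ x∈₁)) (proj₁ (subscript-bounds _ r₂ x∈₂))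

union : ∀ {n} → (Fin n → Bool) → (Fin n → Bool) → Fin n → Bool
union X Y o = X o ∨ Y o

-- Unique occurrences in one-unambiguous expressions.

module _ {k : ℕ} where

  private
    Letter = Fin k

  -- One-unambiguity in positive form: equality of marked symbols is decidable, which removes the
  -- negated inequality. The membership conditions hold because every letter of a word of `r ♭`
  -- occurs in `r ♭`.
  same-letter : {r : Regexp Letter} → OneUnambiguous r → ∀ u {x y v w} →
    L (r ♭) (u ++ x ∷ v) → L (r ♭) (u ++ y ∷ w) → x ♮ ≡ y ♮ → x ≡ y
  same-letter 1U u {x} {y} d d′ eq = decidable-stable (≡-dec _≟_ ℕ._≟_ x y) λ x≢y →
    1U (All.tail (All.++⁻ʳ u (L-Sym d′))) (All.++⁻ˡ u (L-Sym d)) (All.tail (All.++⁻ʳ u (L-Sym d)))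
       (L-letter∈Sym u d) (L-letter∈Sym u d′) d d′ x≢y eq

  -- Induction on `p`: both marked words share the part `u` already read and continue with the same
  -- plain letter, hence with the same occurrence. `u` grows along `p` because one-unambiguity
  -- compares words of `r ♭` from their beginning.
  marked-prefix-unique : {r : Regexp Letter} → OneUnambiguous r → ∀ u p {x q z v} →
    L (r ♭) (u ++ p ++ x ∷ q) → L (r ♭) (u ++ z) →
    map _♮ z ≡ map _♮ p ++ x ♮ ∷ v →
    ∃[ q′ ] z ≡ p ++ x ∷ q′ × map _♮ q′ ≡ v
  marked-prefix-unique 1U u p {z = []} d d′ eq with p | eq
  ... | []    | ()
  ... | _ ∷ _ | ()
  marked-prefix-unique {r} 1U u [] {x} {q} {y ∷ z} d d′ eq
    with same-letter 1U u d d′ (sym-eq (∷-injectiveˡ eq))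
  ... | refl = z , refl , ∷-injectiveʳ eq
  marked-prefix-unique {r} 1U u (x ∷ p) {z = y ∷ z} d d′ eq
    with same-letter 1U u d d′ (sym-eq (∷-injectiveˡ eq))
  ... | refl
    with marked-prefix-unique 1U (u ++ [ x ]) p
           (subst (L (r ♭)) (sym-eq (++-assoc u [ x ] _)) d)
           (subst (L (r ♭)) (sym-eq (++-assoc u [ x ] _)) d′) (∷-injectiveʳ eq)
  ... | q′ , refl , eq′ = q′ , refl , eq′

  -- Observations of a language and the complement expression.

  -- inhabited: there is a word; end: the empty word is one; letter b: there is
  -- a word starting with b.
  Obs : Set
  Obs = Fin (suc (suc k))

  pattern inhabited = zero
  pattern end       = suc zero
  pattern letter b  = suc (suc b)

  obs : List Letter → Obs
  obs []      = end
  obs (b ∷ _) = letter b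

  Info : Set
  Info = Obs → Bool

  del-end : Info → Info
  del-end X inhabited  = X inhabited
  del-end X end        = false
  del-end X (letter b) = X (letter b)

  -- What can be observed at the start of a word of `X` followed by one of `Y`: an empty first part
  -- exposes the start of `Y`, and then `end` can only come from `Y`. This presupposes that the
  -- second language is nonempty; `cat` adds the case where it is empty.
  seq : Info → Info → Info
  seq X Y = if X end then union (del-end X) Y else X

  I-∅ I-ε : Info
  I-∅ _ = false
  I-ε inhabited  = true
  I-ε end        = true
  I-ε (letter _) = false

  I-sym : Letter → Info
  I-sym a inhabited  = true
  I-sym a end        = false
  I-sym a (letter b) = isYes (b ≟ a)

  cat : Info → Info → Info
  cat X Y = if Y inhabited then seq X Y else I-∅

  info : Regexp Letter → Info
  info ∅         = I-∅
  info ε         = I-ε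
  info (sym a)   = I-sym a
  info (r₁ · r₂) = cat (info r₁) (info r₂)
  info (r₁ ⊕ r₂) = union (info r₁) (info r₂)
  info (r ⋆)     = union (info r) I-ε

  -- Each term goes outside the sum accumulated so far. In Polish notation it is thus written in
  -- front of the existing output, which is how `rejectE` produces it.
  ⨁ : ∀ {n} → (Fin n → Regexp Letter) → Regexp Letter → Regexp Letter
  ⨁ {zero}  f r = r
  ⨁ {suc n} f r = ⨁ (f ∘ suc) (f zero ⊕ r)

  unless : Bool → Regexp Letter → Regexp Letter
  unless b r = if b then ∅ else r

  any⋆ : Regexp Letter
  any⋆ = ⨁ sym ∅ ⋆

  -- The words whose first observation fails `X`. The size depends on the alphabet only, so that a
  -- copy at every symbol of `r` costs constant time each.
  reject : Info → Regexp Letter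
  reject X = ⨁ (λ b → unless (X (letter b)) (sym b · any⋆)) (unless (X end) ε)

  -- If L r₂ is empty, occurrences in r₁ lie on no word of the marked expression
  -- and unambiguity says nothing about them (b ∅ + b c is one-unambiguous):
  -- this is why dead (r₁ · r₂) must then be ∅.  In the case of r ⋆, the use of
  -- seq (info (r ⋆)) makes C follow r without letting the empty word of r count
  -- as the end of the input.
  dead : Regexp Letter → Info → Regexp Letter
  dead ∅         C = ∅
  dead ε         C = ∅
  dead (sym a)   C = sym a · reject C
  dead (r₁ · r₂) C =
    if info r₂ inhabited then dead r₁ (seq (info r₂) C) ⊕ r₁ · dead r₂ C else ∅
  dead (r₁ ⊕ r₂) C = dead r₁ C ⊕ dead r₂ C
  dead (r ⋆)     C = r ⋆ · dead r (seq (info (r ⋆)) C)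

  complement : Regexp Letter → Regexp Letter
  complement r = reject (info r) ⊕ dead r I-ε

  -- Correctness of sums, rejection and observations.

  ⨁-base : ∀ {n} (f : Fin n → Regexp Letter) {r w} → L r w → L (⨁ f r) w
  ⨁-base {zero}  f d = d
  ⨁-base {suc n} f d = ⨁-base (f ∘ suc) (right d)

  ⨁-term : ∀ {n} (f : Fin n → Regexp Letter) {r w} i → L (f i) w → L (⨁ f r) w
  ⨁-term f zero    d = ⨁-base (f ∘ suc) (left d)
  ⨁-term f (suc i) d = ⨁-term (f ∘ suc) i d

  ⨁-split : ∀ {n} (f : Fin n → Regexp Letter) {r w} → L (⨁ f r) w → L r w ⊎ ∃[ i ] L (f i) w
  ⨁-split {zero}  f d = inj₁ d
  ⨁-split {suc n} f d with ⨁-split (f ∘ suc) d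
  ... | inj₁ (left e)  = inj₂ (zero , e)
  ... | inj₁ (right e) = inj₁ e
  ... | inj₂ (i , e)   = inj₂ (suc i , e)

  any⋆-full : ∀ w → L any⋆ w
  any⋆-full []      = done
  any⋆-full (a ∷ w) = more {u = [ a ]} (⨁-term sym a symbol) (any⋆-full w)

  unless-intro : ∀ {b r w} → ¬ T b → L r w → L (unless b r) w
  unless-intro {false} _  d = d
  unless-intro {true}  ¬t d = ⊥-elim (¬t _)

  unless-elim : ∀ {b r w} → L (unless b r) w → ¬ T b × L r w
  unless-elim {false} d = (λ ()) , d

  reject-intro : ∀ X w → ¬ T (X (obs w)) → L (reject X) w
  reject-intro X []      ¬t =
    ⨁-base (λ b → unless (X (letter b)) (sym b · any⋆)) (unless-intro ¬t empty)
  reject-intro X (b ∷ w) ¬t =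
    ⨁-term _ b (unless-intro ¬t (concat {u = [ b ]} symbol (any⋆-full w)))

  reject-elim : ∀ X {w} → L (reject X) w → ¬ T (X (obs w))
  reject-elim X d with ⨁-split (λ b → unless (X (letter b)) (sym b · any⋆)) d
  ... | inj₁ e with unless-elim {r = ε} e
  ...   | ¬t , empty = ¬t
  reject-elim X d | inj₂ (b , e) with unless-elim {r = sym b · any⋆} e
  ...   | ¬t , concat symbol _ = ¬t

  seq-left : ∀ X Y o → o ≢ end → T (X o) → T (seq X Y o)
  seq-left X Y o ≢end t with X end
  ... | false = t
  seq-left X Y inhabited  ≢end t | true = Equivalence.from T-∨ (inj₁ t)
  seq-left X Y end        ≢end t | true = contradiction refl ≢end
  seq-left X Y (letter _) ≢end t | true = Equivalence.from T-∨ (inj₁ t)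

  seq-right : ∀ X Y o → T (X end) → T (Y o) → T (seq X Y o)
  seq-right X Y o e t with X end
  ... | true = Equivalence.from T-∨ (inj₂ t)

  seq-split : ∀ X Y o → T (seq X Y o) → (o ≢ end × T (X o)) ⊎ (T (X end) × T (Y o))
  seq-split X Y o t with X end in eq
  ... | false = inj₁ ((λ { refl → subst T eq t }) , t)
  ... | true with Equivalence.to T-∨ t
  ...   | inj₂ t′ = inj₂ (_ , t′)
  seq-split X Y inhabited  t | true | inj₁ t′ = inj₁ ((λ ()) , t′)
  seq-split X Y end        t | true | inj₁ ()
  seq-split X Y (letter _) t | true | inj₁ t′ = inj₁ ((λ ()) , t′)

  seq-obs : ∀ X Y u {v} → T (X (obs u)) → T (Y (obs v)) → T (seq X Y (obs (u ++ v)))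
  seq-obs X Y []      s t = seq-right X Y _ s t
  seq-obs X Y (_ ∷ _) s t = seq-left X Y _ (λ ()) s

  cat-intro : ∀ X Y o → T (Y inhabited) → T (seq X Y o) → T (cat X Y o)
  cat-intro X Y o _ t with Y inhabited
  ... | true = t

  cat-elim : ∀ X Y o → T (cat X Y o) → T (Y inhabited) × T (seq X Y o)
  cat-elim X Y o t with Y inhabited
  ... | true = _ , t

  -- The two observations are proved together, since every observation of a concatenation needs
  -- `inhabited` of its right factor.
  info-complete : ∀ {r w} → L r w → T (info r inhabited) × T (info r (obs w))
  info-complete empty  = _ , _
  info-complete {sym a} symbol = _ , fromWitness {a? = a ≟ a} refl
  info-complete {r₁ · r₂} (concat {u = u} d d′) with info-complete d | info-complete d′
  ... | s₁ , t₁ | s₂ , t₂ =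
    cat-intro X Y inhabited s₂ (seq-left X Y inhabited (λ ()) s₁) ,
    cat-intro X Y _ s₂ (seq-obs X Y u t₁ t₂)
    where
    X = info r₁
    Y = info r₂
  info-complete (left d) with info-complete d
  ... | s , t = Equivalence.from T-∨ (inj₁ s) , Equivalence.from T-∨ (inj₁ t)
  info-complete {r₁ ⊕ r₂} (right d) with info-complete d
  ... | s , t = Equivalence.from (T-∨ {info r₁ inhabited}) (inj₂ s) , Equivalence.from (T-∨ {info r₁ _}) (inj₂ t)
  info-complete {r ⋆} done = Equivalence.from (T-∨ {info r _}) (inj₂ _) , Equivalence.from (T-∨ {info r _}) (inj₂ _)
  info-complete {r ⋆} (more {u = []} d d′) = info-complete d′
  info-complete {r ⋆} (more {u = b ∷ u} d d′) with info-complete d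
  ... | s , t = Equivalence.from T-∨ (inj₁ s) , Equivalence.from T-∨ (inj₁ t)

  info-end : ∀ r → T (info r end) → L r []
  info-end ε _ = empty
  info-end (r₁ · r₂) t with cat-elim (info r₁) (info r₂) end t
  ... | _ , t′ with seq-split (info r₁) (info r₂) end t′
  ...   | inj₁ (≢end , _) = contradiction refl ≢end
  ...   | inj₂ (t₁ , t₂)  = concat {u = []} (info-end r₁ t₁) (info-end r₂ t₂)
  info-end (r₁ ⊕ r₂) t with Equivalence.to T-∨ t
  ... | inj₁ t₁ = left (info-end r₁ t₁)
  ... | inj₂ t₂ = right (info-end r₂ t₂)
  info-end (r ⋆) _ = done

  info-inhabited : ∀ r → T (info r inhabited) → ∃ (L r)
  info-inhabited ε _ = _ , empty
  info-inhabited (sym a) _ = _ , symbol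
  info-inhabited (r₁ · r₂) t with cat-elim (info r₁) (info r₂) inhabited t
  ... | t₂ , t′ with info-inhabited r₂ t₂ | seq-split (info r₁) (info r₂) inhabited t′
  ...   | _ , d₂ | inj₁ (_ , t₁) = _ , concat (proj₂ (info-inhabited r₁ t₁)) d₂
  ...   | _ , d₂ | inj₂ (e , _)  = _ , concat (info-end r₁ e) d₂
  info-inhabited (r₁ ⊕ r₂) t with Equivalence.to T-∨ t
  ... | inj₁ t₁ = _ , left (proj₂ (info-inhabited r₁ t₁))
  ... | inj₂ t₂ = _ , right (proj₂ (info-inhabited r₂ t₂))
  info-inhabited (r ⋆) _ = [] , done

  -- Every word is accepted or dies.

  dead-·ˡ : ∀ r₁ r₂ {C w} → T (info r₂ inhabited) → L (dead r₁ (seq (info r₂) C)) w → L (dead (r₁ · r₂) C) w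
  dead-·ˡ r₁ r₂ t d with info r₂ inhabited
  ... | true = left d

  dead-·ʳ : ∀ r₁ r₂ {C u v} → T (info r₂ inhabited) → L r₁ u → L (dead r₂ C) v → L (dead (r₁ · r₂) C) (u ++ v)
  dead-·ʳ r₁ r₂ t d d′ with info r₂ inhabited
  ... | true = right (concat d d′)

  dead-·-split : ∀ r₁ r₂ {C w} → L (dead (r₁ · r₂) C) w →
    T (info r₂ inhabited) × L (dead r₁ (seq (info r₂) C) ⊕ r₁ · dead r₂ C) w
  dead-·-split r₁ r₂ d with info r₂ inhabited
  ... | true = _ , d

  -- `C` judges only the first observation of the rest `v`; whatever reads `v` next decides its
  -- further fate.
  Parses : Regexp Letter → Info → Letter → List Letter → Set
  Parses r C b w = ∃₂ λ u v → w ≡ u ++ v × L r (b ∷ u) × T (C (obs v))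

  -- Requiring that r consume the letter b makes the recursion for r ⋆ well-founded.
  parse-or-die : ∀ r C b w → T (info r (letter b)) → Parses r C b w ⊎ L (dead r C) (b ∷ w)
  parse-or-die-⋆ : ∀ r C b w → Acc _<_ (length w) → T (info r (letter b)) →
                   Parses (r ⋆) C b w ⊎ L (dead (r ⋆) C) (b ∷ w)

  parse-or-die (sym a) C b w t with toWitness {a? = b ≟ a} t
  ... | refl with T? (C (obs w))
  ...   | yes t′ = inj₁ ([] , w , refl , symbol , t′)
  ...   | no ¬t′ = inj₂ (concat {u = [ a ]} symbol (reject-intro C w ¬t′))
  parse-or-die (r₁ · r₂) C b w t with cat-elim (info r₁) (info r₂) (letter b) t
  ... | s₂ , t′ with seq-split (info r₁) (info r₂) (letter b) t′
  ...   | inj₂ (e₁ , t₂) with parse-or-die r₂ C b w t₂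
  ...     | inj₁ (u , v , eq , d , c) = inj₁ (u , v , eq , concat {u = []} (info-end r₁ e₁) d , c)
  ...     | inj₂ d = inj₂ (dead-·ʳ r₁ r₂ s₂ (info-end r₁ e₁) d)
  parse-or-die (r₁ · r₂) C b w t | s₂ , t′ | inj₁ (_ , t₁)
    with parse-or-die r₁ (seq (info r₂) C) b w t₁
  ...   | inj₂ d = inj₂ (dead-·ˡ r₁ r₂ s₂ d)
  -- Either `r₂` accepts the empty word and `C` admits `v`, or `v` starts with a letter with which
  -- `r₂` can start. The second case excludes an empty `v`, as `seq` takes `end` from `C` only.
  ...   | inj₁ (u , v , refl , d , c) with seq-split (info r₂) C (obs v) c
  ...     | inj₂ (e₂ , t₂) =
    inj₁ (u , v , refl , subst (L _) (++-identityʳ (b ∷ u)) (concat d (info-end r₂ e₂)) , t₂)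
  parse-or-die (r₁ · r₂) C b w t | s₂ , t′ | inj₁ _ | inj₁ (u , [] , refl , d , c)
          | inj₁ (≢end , _) = contradiction refl ≢end
  parse-or-die (r₁ · r₂) C b w t | s₂ , t′ | inj₁ _ | inj₁ (u , b′ ∷ v , refl , d , c)
          | inj₁ (_ , t₂) with parse-or-die r₂ C b′ v t₂
  ... | inj₁ (u′ , v′ , refl , d′ , c′) =
    inj₁ (u ++ b′ ∷ u′ , v′ , sym-eq (++-assoc u (b′ ∷ u′) v′) , concat d d′ , c′)
  ... | inj₂ d′ = inj₂ (dead-·ʳ r₁ r₂ s₂ d d′)
  parse-or-die (r₁ ⊕ r₂) C b w t with Equivalence.to T-∨ t
  ... | inj₁ t₁ with parse-or-die r₁ C b w t₁
  ...   | inj₁ (u , v , eq , d , c) = inj₁ (u , v , eq , left d , c)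
  ...   | inj₂ d = inj₂ (left d)
  parse-or-die (r₁ ⊕ r₂) C b w t | inj₂ t₂ with parse-or-die r₂ C b w t₂
  ...   | inj₁ (u , v , eq , d , c) = inj₁ (u , v , eq , right d , c)
  ...   | inj₂ d = inj₂ (right d)
  parse-or-die (r ⋆) C b w t with Equivalence.to (T-∨ {info r (letter b)}) t
  ... | inj₁ t₁ = parse-or-die-⋆ r C b w (<-wellFounded _) t₁

  parse-or-die-⋆ r C b w (acc rs) t with parse-or-die r (seq (info (r ⋆)) C) b w t
  ... | inj₂ d = inj₂ (concat {u = []} done d)
  ... | inj₁ (u , v , refl , d , c) with seq-split (info (r ⋆)) C (obs v) c
  ...   | inj₂ (_ , c′) =
    inj₁ (u , v , refl , subst (L _) (++-identityʳ (b ∷ u)) (more d done) , c′)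
  parse-or-die-⋆ r C b w (acc rs) t | inj₁ (u , [] , refl , d , c) | inj₁ (≢end , _) =
    contradiction refl ≢end
  parse-or-die-⋆ r C b w (acc rs) t | inj₁ (u , b′ ∷ v , refl , d , c) | inj₁ (_ , t′)
    with Equivalence.to (T-∨ {info r (letter b′)}) t′
  ... | inj₁ t″
    -- The letter `b′` makes `v` strictly shorter than `u ++ b′ ∷ v`, even if `u` is empty.
    with parse-or-die-⋆ r C b′ v (rs (subst (length v <_) (sym-eq (length-++ u)) (m≤n+m _ _))) t″
  ...   | inj₁ (u′ , v′ , refl , d′ , c′) =
    inj₁ (u ++ b′ ∷ u′ , v′ , sym-eq (++-assoc u (b′ ∷ u′) v′) , more d d′ , c′)
  ...   | inj₂ e with ·-split e
  ...     | x , y , eq , ds , d′ =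
    -- The rest dies after the iterations `x`; the iteration `b ∷ u` just read is put in front of
    -- them.
    inj₂ (subst (L _) (trans (++-assoc (b ∷ u) x y) (cong ((b ∷ u) ++_) (sym-eq eq)))
                (concat (more d ds) d′))

  complement-complete : ∀ r w → L r w ⊎ L (complement r) w
  complement-complete r w with T? (info r (obs w))
  complement-complete r w       | no ¬t = inj₂ (left (reject-intro (info r) w ¬t))
  complement-complete r []      | yes t = inj₁ (info-end r t)
  complement-complete r (b ∷ w) | yes t with parse-or-die r I-ε b w t
  -- `I-ε` admits no letter as follower, so a parse has consumed all of `w`.
  ... | inj₁ (u , [] , eq , d , _) = inj₁ (subst (λ z → L r (b ∷ z)) (sym-eq (trans eq (++-identityʳ u))) d)
  ... | inj₂ d = inj₂ (right d)

  -- Dead words are not accepted.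

  -- w = (p x)♮ v dies at the occurrence x: no word of L r leads through x to a
  -- continuation accepted by C and unmarking to v.
  DiesAt : ∀ (i : ℕ) (r : Regexp Letter) (C : Info) (w : List Letter) → Set
  DiesAt i r C w = ∃[ p ] ∃[ x ] ∃[ q ] ∃[ v ]
    w ≡ map _♮ p ++ x ♮ ∷ v ×
    L (markFrom i r) (p ++ x ∷ q) ×
    (∀ p′ q′ κ → L (markFrom i r) (p′ ++ x ∷ q′) → T (C (obs κ)) → map _♮ q′ ++ κ ≢ v)

  -- The occurrence `x` is the one found in the subexpression where the word dies. By disjointness
  -- of subscripts, any word through `x` passes through that same subexpression. What it reads after
  -- leaving it, followed by `κ`, starts as the follower set passed down allows, so the
  -- subexpression is already stuck.
  dead-dies : ∀ i r {C w} → L (dead r C) w → DiesAt i r C w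
  dead-dies i (sym a) {C} (concat {v = v} symbol d) =
    [] , (a , i) , [] , v , refl , symbol ,
    λ { [] [] κ symbol c refl → reject-elim C d c ; (_ ∷ []) _ _ () _ _ ; (_ ∷ _ ∷ _) _ _ () _ _}
  dead-dies i (r₁ · r₂) {C} d with dead-·-split r₁ r₂ d
  ... | s₂ , left d₁ with dead-dies i r₁ d₁
  -- A word of `r₂` is needed to complete the word of `r₁` through `x`; the guard in `dead` provides
  -- it.
  ...   | p , x , q , v , eq , l , stuck with mark (i + length (Sym r₁)) r₂ (proj₂ (info-inhabited r₂ s₂))
  ...     | z , _ , l₂ = p , x , q ++ z , v , eq , subst (L _) (++-assoc p (x ∷ q) z) (concat l l₂) , stuck′
    where
    stuck′ : ∀ p′ q′ κ → L (markFrom i (r₁ · r₂)) (p′ ++ x ∷ q′) → T (C (obs κ)) → map _♮ q′ ++ κ ≢ v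
    stuck′ p′ q′ κ m c eq′ with ·-split m
    ... | z₁ , z₂ , e , m₁ , m₂ with ++-split z₁ p′ (sym-eq e)
    ...   | inj₁ (q₁ , refl , refl) =
      stuck p′ q₁ (map _♮ z₂ ++ κ) m₁
        (seq-obs (info r₂) C (map _♮ z₂) (proj₂ (info-complete (unmark _ r₂ m₂))) c)
        (trans (sym-eq (trans (cong (_++ κ) (map-++ _♮ q₁ z₂)) (++-assoc (map _♮ q₁) _ κ))) eq′)
    ...   | inj₂ (p₁ , refl , _) =
      disjoint-Sym i r₁ r₂ (L-letter∈Sym p l) (L-letter∈Sym p₁ m₂)
  dead-dies i (r₁ · r₂) {C} d | s₂ , right (concat d₁ d₂) with mark i r₁ d₁ | dead-dies (i + length (Sym r₁)) r₂ d₂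
  ... | z , refl , l₁ | p , x , q , v , refl , l , stuck =
    z ++ p , x , q , v ,
    sym-eq (trans (cong (_++ _) (map-++ _♮ z p)) (++-assoc (map _♮ z) _ _)) ,
    subst (L _) (sym-eq (++-assoc z p (x ∷ q))) (concat l₁ l) , stuck′
    where
    stuck′ : ∀ p′ q′ κ → L (markFrom i (r₁ · r₂)) (p′ ++ x ∷ q′) → T (C (obs κ)) → map _♮ q′ ++ κ ≢ v
    stuck′ p′ q′ κ m c eq′ with ·-split m
    ... | z₁ , z₂ , e , m₁ , m₂ with ++-split z₁ p′ (sym-eq e)
    ...   | inj₁ (q₁ , refl , _) =
      disjoint-Sym i r₁ r₂ (L-letter∈Sym p′ m₁) (L-letter∈Sym p l)
    ...   | inj₂ (p₁ , refl , _) = stuck p₁ q′ κ m₂ c eq′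
  dead-dies i (r₁ ⊕ r₂) (left d) with dead-dies i r₁ d
  ... | p , x , q , v , eq , l , stuck = p , x , q , v , eq , left l ,
    λ { p′ q′ κ (left m)  c → stuck p′ q′ κ m c
      ; p′ q′ κ (right m) c _ → disjoint-Sym i r₁ r₂ (L-letter∈Sym p l) (L-letter∈Sym p′ m) }
  dead-dies i (r₁ ⊕ r₂) (right d) with dead-dies (i + length (Sym r₁)) r₂ d
  ... | p , x , q , v , eq , l , stuck = p , x , q , v , eq , right l ,
    λ { p′ q′ κ (right m) c → stuck p′ q′ κ m c
      ; p′ q′ κ (left m)  c _ → disjoint-Sym i r₁ r₂ (L-letter∈Sym p′ m) (L-letter∈Sym p l) }
  dead-dies i (r ⋆) {C} (concat ds d) with mark i (r ⋆) ds | dead-dies i r d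
  ... | z , refl , l₁ | p , x , q , v , refl , l , stuck =
    z ++ p , x , q , v ,
    sym-eq (trans (cong (_++ _) (map-++ _♮ z p)) (++-assoc (map _♮ z) _ _)) ,
    subst (L _) (sym-eq (++-assoc z p (x ∷ q))) (⋆-snoc l₁ l) , stuck′
    where
    stuck′ : ∀ p′ q′ κ → L (markFrom i (r ⋆)) (p′ ++ x ∷ q′) → T (C (obs κ)) → map _♮ q′ ++ κ ≢ v
    -- The iteration containing `x` is isolated, and the later iterations are counted as part of its
    -- continuation.
    stuck′ p′ q′ κ m c eq′ with ⋆-split p′ m refl
    ... | p₁ , q₁ , z₂ , m₁ , refl , m₂ =
      stuck p₁ q₁ (map _♮ z₂ ++ κ) m₁
        (seq-obs (info (r ⋆)) C (map _♮ z₂) (proj₂ (info-complete (unmark i (r ⋆) m₂))) c)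
        (trans (sym-eq (trans (cong (_++ κ) (map-++ _♮ q₁ z₂)) (++-assoc (map _♮ q₁) _ κ))) eq′)

  -- By one-unambiguity a marked word of `r ♭` over the same letters must begin with the dying
  -- prefix `p` and `x`. Its remainder, with empty `κ`, is then an accepted continuation, which
  -- `DiesAt` forbids.
  complement-sound : ∀ r → OneUnambiguous r → ∀ {w} → L (complement r) w → ¬ L r w
  complement-sound r 1U (left d) m = reject-elim (info r) d (proj₂ (info-complete m))
  complement-sound r 1U (right d) m with dead-dies 1 r d | mark 1 r m
  ... | p , x , q , v , eq , l , stuck | z , eq′ , l′
    with marked-prefix-unique 1U [] p l l′ (trans eq′ eq)
  ...   | q′ , refl , eq″ = stuck p q′ [] l′ _ (trans (++-identityʳ _) eq″)

  complement-correct : ∀ r → OneUnambiguous r → L (complement r) ≐ ∁ (L r)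
  complement-correct r 1U = complement-sound r 1U , λ {w} ¬m → complete w ¬m
    where
    complete : ∀ w → ¬ L r w → L (complement r) w
    complete w ¬m with complement-complete r w
    ... | inj₁ m = contradiction m ¬m
    ... | inj₂ d = d

-- Time bounds by weakest preconditions.

module _ {A : Set} {m : ℕ} where

  nodes : ∀ {n} → Expr A m n → ℕ
  nodes (var _)           = 1
  nodes nil               = 1
  nodes (atom _)          = 1
  nodes (cons e₁ e₂)      = suc (nodes e₁ + nodes e₂)
  nodes (car e)           = suc (nodes e)
  nodes (cdr e)           = suc (nodes e)
  nodes (ifCons e e₁ e₂)  = suc (nodes e + (nodes e₁ + nodes e₂))
  nodes (ifEq e e′ e₁ e₂) = suc (nodes e + nodes e′ + (nodes e₁ + nodes e₂))
  nodes (let′ e e₁)       = suc (nodes e + nodes e₁)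
  nodes (call _ e)        = suc (nodes e)

module _ {A : Set} where

  -- Reduces as soon as the tree is known to be a cell or not, so that preconditions of concrete
  -- programs simplify by computation.
  CaseCons : Value A → Set → Set → Set
  CaseCons (cons _ _) P Q = P
  CaseCons _          P Q = Q

  CaseCons-split : ∀ v {P Q} → CaseCons v P Q → (IsCons v × P) ⊎ (¬ IsCons v × Q)
  CaseCons-split nil        q = inj₂ ((λ ()) , q)
  CaseCons-split (atom _)   q = inj₂ ((λ ()) , q)
  CaseCons-split (cons _ _) p = inj₁ (cons , p)

  prefix : List A → Value A → Value A
  prefix []       v = v
  prefix (a ∷ as) v = cons (atom a) (prefix as v)

  prefix-list : ∀ as bs → prefix as (list bs) ≡ list (as ++ bs)
  prefix-list []       bs = refl
  prefix-list (a ∷ as) bs = cong (cons (atom a)) (prefix-list as bs)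

  prefixE : ∀ {m n} → List A → Expr A m n → Expr A m n
  prefixE []       e = e
  prefixE (a ∷ as) e = cons (atom a) (prefixE as e)

module _ {A : Set} {m : ℕ} (body : Fin m → Expr A m 1) where

  Runs : Fin m → Value A → Value A → ℕ → Set
  Runs f v w b = ∃[ t ] Eval body (v ∷ᵛ []ᵛ) (body f) w t × t ≤ b

  -- Weakest precondition.  The number passed along is the time spent in calls so far;
  -- everything else is bounded by the number of nodes of the expression, since
  -- each node is evaluated at most once.
  wp : ∀ {n} → Expr A m n → Vec (Value A) n → ℕ → (Value A → ℕ → Set) → Set
  wp (var i)           ρ b Q = Q (lookup ρ i) b
  wp nil               ρ b Q = Q nil b
  wp (atom a)          ρ b Q = Q (atom a) b
  wp (cons e₁ e₂)      ρ b Q = wp e₁ ρ b λ v b → wp e₂ ρ b λ w → Q (cons v w)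
  wp (car e)           ρ b Q = wp e ρ b λ v → Q (head v)
  wp (cdr e)           ρ b Q = wp e ρ b λ v → Q (tail v)
  wp (ifCons e e₁ e₂)  ρ b Q = wp e ρ b λ v b → CaseCons v (wp e₁ ρ b Q) (wp e₂ ρ b Q)
  wp (ifEq e e′ e₁ e₂) ρ b Q = wp e ρ b λ v b → wp e′ ρ b λ w b →
    (SameAtom v w × wp e₁ ρ b Q) ⊎ (¬ SameAtom v w × wp e₂ ρ b Q)
  wp (let′ e e₁)       ρ b Q = wp e ρ b λ v b → wp e₁ (v ∷ᵛ ρ) b Q
  wp (call f e)        ρ b Q = wp e ρ b λ v b → ∃₂ λ w c → Runs f v w c × Q w (b + c)

  -- The bound says that the time is at most the number of nodes plus the call time `b′` minus `b`,
  -- written without subtraction.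
  Outcome : ∀ {n} → Expr A m n → Vec (Value A) n → ℕ → (Value A → ℕ → Set) → Set
  Outcome e ρ b Q = ∃[ v ] ∃[ t ] ∃[ b′ ] Eval body ρ e v t × t + b ≤ nodes e + b′ × Q v b′

  private
    add-bounds : ∀ t t₁ {b b₁ b₂} n n₁ → t + b ≤ n + b₁ → t₁ + b₁ ≤ n₁ + b₂ →
                 t + t₁ + b ≤ n + n₁ + b₂
    add-bounds t t₁ {b} {b₁} {b₂} n n₁ p q = +-cancelʳ-≤ b₁ _ _ (begin
      t + t₁ + b + b₁     ≡⟨ split t t₁ b b₁ ⟩
      t + b + (t₁ + b₁)   ≤⟨ +-mono-≤ p q ⟩
      n + b₁ + (n₁ + b₂)  ≡⟨ merge n b₁ n₁ b₂ ⟩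
      n + n₁ + b₂ + b₁    ∎)
      where
      open ≤-Reasoning
      split : ∀ t t₁ b b₁ → t + t₁ + b + b₁ ≡ t + b + (t₁ + b₁)
      split = solve-∀
      merge : ∀ n b₁ n₁ b₂ → n + b₁ + (n₁ + b₂) ≡ n + n₁ + b₂ + b₁
      merge = solve-∀

    weakenˡ : ∀ {x b} n₁ n₂ → x ≤ n₁ + b → x ≤ n₁ + n₂ + b
    weakenˡ {b = b} n₁ n₂ p = ≤-trans p (+-monoˡ-≤ b (m≤m+n n₁ n₂))

    weakenʳ : ∀ {x b} n₁ n₂ → x ≤ n₂ + b → x ≤ n₁ + n₂ + b
    weakenʳ {b = b} n₁ n₂ p = ≤-trans p (+-monoˡ-≤ b (m≤n+m n₂ n₁))

  wp-sound : ∀ {n} (e : Expr A m n) {ρ b Q} → wp e ρ b Q → Outcome e ρ b Q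
  wp-sound (var i)  q = _ , _ , _ , var , ≤-refl , q
  wp-sound nil      q = _ , _ , _ , nil , ≤-refl , q
  wp-sound (atom a) q = _ , _ , _ , atom , ≤-refl , q
  wp-sound (cons e₁ e₂) h with wp-sound e₁ h
  ... | _ , t₁ , _ , d₁ , l₁ , h₂ with wp-sound e₂ h₂
  ...   | _ , t₂ , _ , d₂ , l₂ , q =
    _ , _ , _ , cons d₁ d₂ , s≤s (add-bounds t₁ t₂ (nodes e₁) (nodes e₂) l₁ l₂) , q
  wp-sound (car e) h with wp-sound e h
  ... | _ , t , _ , d , l , q = _ , _ , _ , car d , s≤s l , q
  wp-sound (cdr e) h with wp-sound e h
  ... | _ , t , _ , d , l , q = _ , _ , _ , cdr d , s≤s l , q
  wp-sound (ifCons e e₁ e₂) h with wp-sound e h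
  ... | v , t , _ , d , l , c with CaseCons-split v c
  ...   | inj₁ (y , h₁) with wp-sound e₁ h₁
  ...     | _ , t₁ , _ , d₁ , l₁ , q = _ , _ , _ , ifCons-yes d y d₁ ,
    s≤s (add-bounds t t₁ (nodes e) _ l (weakenˡ (nodes e₁) (nodes e₂) l₁)) , q
  wp-sound (ifCons e e₁ e₂) h | v , t , _ , d , l , c | inj₂ (n , h₂) with wp-sound e₂ h₂
  ...     | _ , t₂ , _ , d₂ , l₂ , q = _ , _ , _ , ifCons-no d n d₂ ,
    s≤s (add-bounds t t₂ (nodes e) _ l (weakenʳ (nodes e₁) (nodes e₂) l₂)) , q
  wp-sound (ifEq e e′ e₁ e₂) h with wp-sound e h
  ... | _ , t , _ , d , l , h′ with wp-sound e′ h′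
  ...   | _ , t′ , _ , d′ , l′ , inj₁ (y , h₁) with wp-sound e₁ h₁
  ...     | _ , t₁ , _ , d₁ , l₁ , q = _ , _ , _ , ifEq-yes d d′ y d₁ ,
    s≤s (add-bounds (t + t′) t₁ (nodes e + nodes e′) _ (add-bounds t t′ (nodes e) (nodes e′) l l′)
          (weakenˡ (nodes e₁) (nodes e₂) l₁)) , q
  wp-sound (ifEq e e′ e₁ e₂) h | _ , t , _ , d , l , h′ | _ , t′ , _ , d′ , l′ , inj₂ (n , h₂)
    with wp-sound e₂ h₂
  ...     | _ , t₂ , _ , d₂ , l₂ , q = _ , _ , _ , ifEq-no d d′ n d₂ ,
    s≤s (add-bounds (t + t′) t₂ (nodes e + nodes e′) _ (add-bounds t t′ (nodes e) (nodes e′) l l′)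
          (weakenʳ (nodes e₁) (nodes e₂) l₂)) , q
  wp-sound (let′ e e₁) h with wp-sound e h
  ... | _ , t , _ , d , l , h₁ with wp-sound e₁ h₁
  ...   | _ , t₁ , _ , d₁ , l₁ , q =
    _ , _ , _ , let′ d d₁ , s≤s (add-bounds t t₁ (nodes e) (nodes e₁) l l₁) , q
  wp-sound (call f e) {b = b} h with wp-sound e h
  ... | _ , t , b₁ , d , l , _ , c , (t₁ , d₁ , t₁≤c) , q = _ , _ , _ , call d d₁ , s≤s (begin
      t + t₁ + b            ≤⟨ +-monoˡ-≤ b (+-monoʳ-≤ t t₁≤c) ⟩
      t + c + b             ≡⟨ swap t c b ⟩
      t + b + c             ≤⟨ +-monoˡ-≤ c l ⟩
      nodes e + b₁ + c      ≡⟨ +-assoc (nodes e) b₁ c ⟩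
      nodes e + (b₁ + c)    ∎) , q
    where
    open ≤-Reasoning
    swap : ∀ t c b → t + c + b ≡ t + b + c
    swap = solve-∀

  -- Abstract, because unfolding it would turn every cost below into a huge numeral.
  abstract
    overhead : ∀ {n} → Expr A m n → ℕ
    overhead = nodes

    evaluates : ∀ {n} (e : Expr A m n) {ρ v B} →
                wp e ρ 0 (λ w b → v ≡ w × overhead e + b ≤ B) → ∃[ t ] Eval body ρ e v t × t ≤ B
    evaluates e h with wp-sound e h
    ... | _ , t , _ , d , l , refl , ≤B = t , d , ≤-trans (subst (_≤ _) (+-identityʳ t) l) ≤B

  runs : ∀ f {v w B} →
         wp (body f) (v ∷ᵛ []ᵛ) 0 (λ u b → w ≡ u × overhead (body f) + b ≤ B) → Runs f v w B
  runs f = evaluates (body f)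

  wp-prefix : ∀ {n} (as : List A) (e : Expr A m n) {ρ b Q} →
              wp e ρ b (λ v → Q (prefix as v)) → wp (prefixE as e) ρ b Q
  wp-prefix []       e h = h
  wp-prefix (a ∷ as) e h = wp-prefix as e h

-- Sets of observations as trees.

bit : ∀ {A} → Bool → Value A
bit true  = cons nil nil
bit false = nil

CaseCons-bit : ∀ {A} b {P Q} → (b ≡ true → P) → (b ≡ false → Q) → CaseCons {A} (bit b) P Q
CaseCons-bit true  p q = p refl
CaseCons-bit false p q = q refl

enc : ∀ {A n} → (Fin n → Bool) → Value A
enc {n = zero}  f = nil
enc {n = suc n} f = cons (bit (f zero)) (enc (f ∘ suc))

module _ {A : Set} {m : ℕ} where

  trueE : ∀ {n} → Expr A m n
  trueE = cons nil nil

  -- The recursion is in the metalanguage: the loop is unrolled into the program text, whose length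
  -- is constant for a fixed alphabet. The same holds of `lettersE` and `rejectE`.
  unionE : ℕ → ∀ {j} → Expr A m (suc (suc j))
  unionE zero    = nil
  unionE (suc n) = cons (ifCons (car (var 1F)) (car (var 1F)) (car (var 0F)))
                        (let′ (cdr (var 1F)) (let′ (cdr (var 1F)) (unionE n)))

  wp-union : ∀ (body : Fin m → Expr A m 1) {n j} (f g : Fin n → Bool) {ρ : Vec (Value A) j} {b Q} →
             Q (enc (union f g)) b → wp body (unionE n) (enc g ∷ᵛ enc f ∷ᵛ ρ) b Q
  wp-union body {zero}  f g q = q
  wp-union body {suc n} f g q with f zero
  ... | true  = wp-union body (f ∘ suc) (g ∘ suc) q
  ... | false = wp-union body (f ∘ suc) (g ∘ suc) q

-- The program.

module Machine (k : ℕ) where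

  Tok : Set
  Tok = Token (Fin k)

  module _ {m : ℕ} where

    lettersE : ∀ {n} → (Fin n → Fin k) → Expr Tok m 1
    lettersE {zero}  σ = nil
    lettersE {suc n} σ = cons (ifEq (var 0F) (atom (‵sym (σ zero))) trueE nil) (lettersE (σ ∘ suc))

    wp-letters : ∀ body (t : Tok) (f : Fin k → Bool) → (∀ i → Reflects (t ≡ ‵sym i) (f i)) →
                 ∀ {n} (σ : Fin n → Fin k) {b Q} →
                 Q (enc (f ∘ σ)) b → wp body (lettersE σ) (atom t ∷ᵛ []ᵛ) b Q
    wp-letters body t f R {zero}  σ q = q
    wp-letters body t f R {suc n} σ q with f (σ zero) | R (σ zero)
    ... | true  | ofʸ refl = inj₁ (atom , wp-letters body t f R (σ ∘ suc) q)
    ... | false | ofⁿ t≢   = inj₂ ((λ { atom → t≢ refl }) , wp-letters body t f R (σ ∘ suc) q)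

    rejectE : ∀ {n} → (Fin n → List Tok) → ∀ {j} → Expr Tok m (suc (suc j))
    rejectE {zero}  ws = var 1F
    rejectE {suc n} ws =
      let′ (cons (atom ‵⊕) (ifCons (car (var 0F)) (cons (atom ‵∅) (var 1F)) (prefixE (ws zero) (var 1F))))
           (let′ (cdr (var 1F)) (rejectE (ws ∘ suc)))

    wp-reject : ∀ body {n} (rs : Fin n → Regexp (Fin k)) (f : Fin n → Bool) r ts
                {j} {ρ : Vec (Value Tok) j} {b Q} →
                Q (list (polish (⨁ (λ i → unless (f i) (rs i)) r) ++ ts)) b →
                wp body (rejectE (polish ∘ rs)) (enc f ∷ᵛ list (polish r ++ ts) ∷ᵛ ρ) b Q
    wp-reject body {zero}  rs f r ts q = q
    wp-reject body {suc n} rs f r ts {ρ = ρ} {b} {Q} q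
      -- The induction hypothesis is abstracted along with `f zero`, so that `unless` in its type
      -- reduces in both branches.
      with f zero | wp-reject body (rs ∘ suc) (f ∘ suc) (unless (f zero) (rs zero) ⊕ r) ts
    ... | true  | ih = ih q
    ... | false | ih = wp-prefix body (polish (rs zero)) (var 1F)
      (subst (λ v → wp body (rejectE (polish ∘ rs ∘ suc))
                            (enc (f ∘ suc) ∷ᵛ cons (atom ‵⊕) v ∷ᵛ cons (bit false) (enc (f ∘ suc))
                              ∷ᵛ list (polish r ++ ts) ∷ᵛ ρ) b Q)
        (sym-eq (trans (prefix-list (polish (rs zero)) (polish r ++ ts))
                       (cong list (sym-eq (++-assoc (polish (rs zero)) (polish r) ts)))))
        (ih q))

  tag : Regexp (Fin k) → Tok
  tag ∅       = ‵∅
  tag ε       = ‵ε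
  tag (sym a) = ‵sym a
  tag (_ · _) = ‵·
  tag (_ ⊕ _) = ‵⊕
  tag (_ ⋆)   = ‵⋆

  -- Each node stores its observations, so that they are computed once, during parsing. Missing
  -- children are `nil`, which lets `f-emit` treat all nodes alike.
  tree subtrees : Regexp (Fin k) → Value Tok
  tree r = cons (atom (tag r)) (cons (enc (info r)) (subtrees r))
  subtrees (r₁ · r₂) = cons (tree r₁) (tree r₂)
  subtrees (r₁ ⊕ r₂) = cons (tree r₁) (tree r₂)
  subtrees (r ⋆)     = cons (tree r) nil
  subtrees _         = cons nil nil

  pattern f-parse  = 0F
  pattern f-leaf   = 1F
  pattern f-union  = 2F
  pattern f-seq    = 3F
  pattern f-cat    = 4F
  pattern f-emit   = 5F
  pattern f-reject = 6F
  pattern f-dead   = 7F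

  E : ℕ → Set
  E = Expr Tok 8

  infoE leftE rightE inhabitedE endE : ∀ {n} → E n → E n
  infoE e      = car (cdr e)
  leftE e      = car (cdr (cdr e))
  rightE e     = cdr (cdr (cdr e))
  inhabitedE e = car e
  endE e       = car (cdr e)

  nodeE : ∀ {n} → E n → E n → E n → E n → E n
  nodeE t I l r = cons t (cons I (cons l r))

  switch : ∀ {n} → E n → (dot plus star none one other : E n) → E n
  switch e dot plus star none one other =
    ifEq e (atom ‵·) dot (ifEq e (atom ‵⊕) plus (ifEq e (atom ‵⋆) star
      (ifEq e (atom ‵∅) none (ifEq e (atom ‵ε) one other))))

  parseBin : Tok → Fin 8 → E 1
  parseBin t f =
    let′ (call f-parse (cdr (var 0F)))
      (let′ (call f-parse (cdr (var 0F)))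
        (cons (nodeE (atom t) (call f (cons (infoE (car (var 1F))) (infoE (car (var 0F)))))
                     (car (var 1F)) (car (var 0F)))
              (cdr (var 0F))))

  parseLeaf : E 1
  parseLeaf = cons (nodeE (car (var 0F)) (call f-leaf (car (var 0F))) nil nil) (cdr (var 0F))

  -- Environment in the branches of f-dead: 2 is the tree, 1 the set of followers
  -- and 0 the output written so far, to which the new output is prepended.
  body : Fin 8 → E 1
  body f-parse =
    switch (car (var 0F)) (parseBin ‵· f-cat) (parseBin ‵⊕ f-union)
      (let′ (call f-parse (cdr (var 0F)))
        (cons (nodeE (atom ‵⋆) (call f-union (cons (infoE (car (var 0F))) (call f-leaf (atom ‵ε))))
                     (car (var 0F)) nil)
              (cdr (var 0F))))
      parseLeaf parseLeaf parseLeaf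
  body f-leaf =
    cons (ifEq (var 0F) (atom ‵∅) nil trueE) (cons (ifEq (var 0F) (atom ‵ε) trueE nil) (lettersE id))
  body f-union = let′ (car (var 0F)) (let′ (cdr (var 1F)) (unionE (suc (suc k))))
  body f-seq =
    ifCons (endE (car (var 0F)))
      (call f-union (cons (cons (car (car (var 0F))) (cons nil (cdr (cdr (car (var 0F)))))) (cdr (var 0F))))
      (car (var 0F))
  body f-cat = ifCons (inhabitedE (cdr (var 0F))) (call f-seq (var 0F)) (call f-leaf (atom ‵∅))
  body f-emit =
    -- The right subtree is written first, because output is prepended to what is already written;
    -- no lists are ever concatenated.
    ifCons (car (var 0F))
      (cons (car (car (var 0F)))
            (call f-emit (cons (leftE (car (var 0F)))
                               (call f-emit (cons (rightE (car (var 0F))) (cdr (var 0F)))))))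
      (cdr (var 0F))
  body f-reject =
    let′ (cons (ifCons (endE (car (var 0F))) (atom ‵∅) (atom ‵ε)) (cdr (var 0F)))
      (let′ (cdr (cdr (car (var 1F)))) (rejectE (λ b → polish (sym b · any⋆))))
  body f-dead =
    let′ (car (var 0F)) (let′ (car (cdr (var 1F))) (let′ (cdr (cdr (var 2F)))
      (switch (car (var 2F))
        (ifCons (inhabitedE (infoE (rightE (var 2F))))
          (cons (atom ‵⊕) (call f-dead (cons (leftE (var 2F))
            (cons (call f-seq (cons (infoE (rightE (var 2F))) (var 1F)))
              (cons (atom ‵·) (call f-emit (cons (leftE (var 2F))
                (call f-dead (cons (rightE (var 2F)) (cons (var 1F) (var 0F)))))))))))
          (cons (atom ‵∅) (var 0F)))
        (cons (atom ‵⊕) (call f-dead (cons (leftE (var 2F)) (cons (var 1F)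
          (call f-dead (cons (rightE (var 2F)) (cons (var 1F) (var 0F))))))))
        (cons (atom ‵·) (call f-emit (cons (var 2F)
          (call f-dead (cons (leftE (var 2F))
            (cons (call f-seq (cons (infoE (var 2F)) (var 1F))) (var 0F)))))))
        (cons (atom ‵∅) (var 0F))
        (cons (atom ‵∅) (var 0F))
        (cons (atom ‵·) (cons (car (var 2F)) (call f-reject (cons (var 1F) (var 0F))))))))

  mainE : E 1
  mainE =
    let′ (car (call f-parse (var 0F)))
      (cons (atom ‵⊕) (call f-reject (cons (infoE (var 0F))
        (call f-dead (cons (var 0F) (cons (call f-leaf (atom ‵ε)) nil))))))

  -- Correctness and cost of each function.

  parseOverhead deadOverhead : ℕ
  parseOverhead = overhead body (body f-parse)
  deadOverhead  = overhead body (body f-dead)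

  -- `parseCost` and `deadCost` add up the callees of all branches, so that one constant serves
  -- every kind of node. In `deadCost`, `3 * emitCost` is the rate at which a subexpression is
  -- copied.
  leafCost unionCost seqCost catCost rejectCost emitCost parseCost deadCost : ℕ
  leafCost   = overhead body (body f-leaf)
  unionCost  = overhead body (body f-union)
  seqCost    = overhead body (body f-seq) + unionCost
  catCost    = overhead body (body f-cat) + (seqCost + leafCost)
  rejectCost = overhead body (body f-reject)
  emitCost   = overhead body (body f-emit)
  parseCost  = parseOverhead + (leafCost + unionCost + catCost)
  deadCost   = deadOverhead + (seqCost + rejectCost + 3 * emitCost)

  Computes : Fin 8 → Value Tok → Value Tok → ℕ → Set
  Computes = Runs body

  leaf-∅ : Computes f-leaf (atom ‵∅) (enc I-∅) leafCost
  leaf-∅ = runs body f-leaf (inj₁ (atom , inj₂ ((λ ()) ,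
    wp-letters body ‵∅ (λ _ → false) (λ _ → ofⁿ λ ()) id (refl , ≤-reflexive (+-identityʳ _)))))

  leaf-ε : Computes f-leaf (atom ‵ε) (enc I-ε) leafCost
  leaf-ε = runs body f-leaf (inj₂ ((λ ()) , inj₁ (atom ,
    wp-letters body ‵ε (λ _ → false) (λ _ → ofⁿ λ ()) id (refl , ≤-reflexive (+-identityʳ _)))))

  leaf-sym : ∀ a → Computes f-leaf (atom (‵sym a)) (enc (I-sym a)) leafCost
  leaf-sym a = runs body f-leaf (inj₂ ((λ ()) , inj₂ ((λ ()) ,
    wp-letters body (‵sym a) (λ b → isYes (b ≟ a)) is-a id (refl , ≤-reflexive (+-identityʳ _)))))
    where
    is-a : ∀ b → Reflects (‵sym a ≡ ‵sym b) (isYes (b ≟ a))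
    is-a b with b ≟ a
    ... | yes refl = ofʸ refl
    ... | no b≢a   = ofⁿ λ { refl → b≢a refl }

  union-runs : (X Y : Info {k}) → Computes f-union (cons (enc X) (enc Y)) (enc (union X Y)) unionCost
  union-runs X Y = runs body f-union (wp-union body X Y
    {Q = λ v b → enc (union X Y) ≡ v × unionCost + b ≤ unionCost} (refl , ≤-reflexive (+-identityʳ _)))

  seq-runs : (X Y : Info {k}) → Computes f-seq (cons (enc X) (enc Y)) (enc (seq X Y)) seqCost
  seq-runs X Y = runs body f-seq (CaseCons-bit (X end)
    (λ eq → _ , _ , union-runs (del-end X) Y , value eq , ≤-refl)
    (λ eq → value eq , +-monoʳ-≤ (overhead body (body f-seq)) z≤n))
    where
    value : ∀ {e} → X end ≡ e → enc {Tok} (seq X Y) ≡ enc (if e then union (del-end X) Y else X)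
    value = cong (λ e → enc (if e then union (del-end X) Y else X))

  cat-runs : (X Y : Info {k}) → Computes f-cat (cons (enc X) (enc Y)) (enc (cat X Y)) catCost
  cat-runs X Y = runs body f-cat (CaseCons-bit (Y inhabited)
    (λ eq → _ , _ , seq-runs X Y , value eq , +-monoʳ-≤ (overhead body (body f-cat)) (m≤m+n _ _))
    (λ eq → _ , _ , leaf-∅ , value eq , +-monoʳ-≤ (overhead body (body f-cat)) (m≤n+m _ _)))
    where
    value : ∀ {e} → Y inhabited ≡ e → enc {Tok} (cat X Y) ≡ enc (if e then seq X Y else I-∅)
    value = cong (λ e → enc (if e then seq X Y else I-∅))

  reject-runs : ∀ (X : Info {k}) ts →
    Computes f-reject (cons (enc X) (list ts)) (list (polish (reject X) ++ ts)) rejectCost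
  reject-runs X ts = runs body f-reject (CaseCons-bit (X end)
    (λ eq → wp-reject body terms (X ∘ letter′) ∅ ts (value eq , ≤-reflexive (+-identityʳ _)))
    (λ eq → wp-reject body terms (X ∘ letter′) ε ts (value eq , ≤-reflexive (+-identityʳ _))))
    where
    letter′ : Fin k → Obs
    letter′ b = letter b
    terms : Fin k → Regexp (Fin k)
    terms b = sym b · any⋆
    value : ∀ {e} → X end ≡ e →
            list (polish (reject X) ++ ts) ≡
            list (polish (⨁ (λ b → unless (X (letter b)) (terms b)) (unless e ε)) ++ ts)
    value = cong (λ e → list (polish (⨁ (λ b → unless (X (letter b)) (terms b)) (unless e ε)) ++ ts))

  linear₁ : ∀ N {o c} n → N + o ≤ c → N + (c * n + o) ≤ c * (n + 1)
  linear₁ N {o} {c} n p = begin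
    N + (c * n + o)  ≡⟨ l N c n o ⟩
    c * n + (N + o)  ≤⟨ +-monoʳ-≤ (c * n) p ⟩
    c * n + c        ≡⟨ r c n ⟩
    c * (n + 1)      ∎
    where
    open ≤-Reasoning
    l : ∀ N c n o → N + (c * n + o) ≡ c * n + (N + o)
    l = solve-∀
    r : ∀ c n → c * n + c ≡ c * (n + 1)
    r = solve-∀

  linear₂ : ∀ N {o c} n₁ n₂ → N + o ≤ c → N + (c * n₁ + c * n₂ + o) ≤ c * (n₁ + n₂ + 1)
  linear₂ N {o} {c} n₁ n₂ p =
    subst (λ x → N + (x + o) ≤ c * (n₁ + n₂ + 1)) (*-distribˡ-+ c n₁ n₂) (linear₁ N (n₁ + n₂) p)

  -- Polish notation is self-delimiting: the parser stops after `r` and hands back the remaining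
  -- input `ts`.
  Parses-to-tree : Regexp (Fin k) → Set
  Parses-to-tree r = ∀ ts →
    Computes f-parse (list (polish r ++ ts)) (cons (tree r) (list ts)) (parseCost * size r)

  parse-bin : ∀ r₁ r₂ {r} f {c} ts → Parses-to-tree r₁ → Parses-to-tree r₂ →
    Computes f (cons (enc (info r₁)) (enc (info r₂))) (enc (info r)) c →
    parseOverhead + c ≤ parseCost →
    subtrees r ≡ cons (tree r₁) (tree r₂) →
    wp body (parseBin (tag r) f) (list (tag r ∷ (polish r₁ ++ polish r₂) ++ ts) ∷ᵛ []ᵛ) 0
       (λ v b → cons (tree r) (list ts) ≡ v
              × parseOverhead + b ≤ parseCost * (size r₁ + size r₂ + 1))
  parse-bin r₁ r₂ f ts h₁ h₂ hf c≤ eq rewrite eq | ++-assoc (polish r₁) (polish r₂) ts =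
    _ , _ , h₁ _ , _ , _ , h₂ ts , _ , _ , hf , refl ,
    linear₂ parseOverhead (size r₁) (size r₂) c≤

  leaf-fits : parseOverhead + leafCost ≤ parseCost * 1
  leaf-fits = ≤-trans
    (+-monoʳ-≤ parseOverhead (≤-trans (m≤m+n leafCost unionCost) (m≤m+n (leafCost + unionCost) catCost)))
    (≤-reflexive (sym-eq (*-identityʳ parseCost)))

  parse-runs : ∀ r → Parses-to-tree r
  parse-runs ∅ ts = runs body f-parse (inj₂ ((λ ()) , inj₂ ((λ ()) , inj₂ ((λ ()) , inj₁ (atom ,
    _ , _ , leaf-∅ , refl , leaf-fits)))))
  parse-runs ε ts = runs body f-parse (inj₂ ((λ ()) , inj₂ ((λ ()) , inj₂ ((λ ()) , inj₂ ((λ ()) , inj₁ (atom ,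
    _ , _ , leaf-ε , refl , leaf-fits))))))
  parse-runs (sym a) ts = runs body f-parse (inj₂ ((λ ()) , inj₂ ((λ ()) , inj₂ ((λ ()) , inj₂ ((λ ()) , inj₂ ((λ ()) ,
    _ , _ , leaf-sym a , refl , leaf-fits))))))
  parse-runs (r₁ · r₂) ts = runs body f-parse (inj₁ (atom ,
    parse-bin r₁ r₂ {r₁ · r₂} f-cat ts (parse-runs r₁) (parse-runs r₂) (cat-runs (info r₁) (info r₂))
      (+-monoʳ-≤ parseOverhead (m≤n+m catCost (leafCost + unionCost))) refl))
  parse-runs (r₁ ⊕ r₂) ts = runs body f-parse (inj₂ ((λ ()) , inj₁ (atom ,
    parse-bin r₁ r₂ {r₁ ⊕ r₂} f-union ts (parse-runs r₁) (parse-runs r₂) (union-runs (info r₁) (info r₂))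
      (+-monoʳ-≤ parseOverhead (≤-trans (m≤n+m unionCost leafCost) (m≤m+n (leafCost + unionCost) catCost))) refl)))
  parse-runs (r ⋆) ts = runs body f-parse (inj₂ ((λ ()) , inj₂ ((λ ()) , inj₁ (atom ,
    _ , _ , parse-runs r ts , _ , _ , leaf-ε , _ , _ , union-runs (info r) I-ε , refl ,
    subst (λ x → parseOverhead + x ≤ parseCost * (size r + 1))
      (sym-eq (+-assoc (parseCost * size r) leafCost unionCost))
      (linear₁ parseOverhead (size r) (+-monoʳ-≤ parseOverhead (m≤m+n (leafCost + unionCost) catCost)))))))

  emit-nil : ∀ ts → Computes f-emit (cons nil (list ts)) (list ts) emitCost
  emit-nil ts = runs body f-emit (refl , ≤-reflexive (+-identityʳ _))

  -- The factor 3 pays for the calls on the nil children of leaves and stars.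
  Emits : Regexp (Fin k) → Set
  Emits r = ∀ ts →
    Computes f-emit (cons (tree r) (list ts)) (list (polish r ++ ts)) (emitCost * (3 * size r))

  emit-leaf : ∀ r → subtrees r ≡ cons nil nil → polish r ≡ [ tag r ] → size r ≡ 1 → Emits r
  emit-leaf r e₁ e₂ e₃ ts rewrite e₁ | e₂ | e₃ = runs body f-emit
    (_ , _ , emit-nil ts , _ , _ , emit-nil ts , refl , ≤-reflexive (triple emitCost))
    where
    triple : ∀ c → c + (c + c) ≡ c * 3
    triple = solve-∀

  emit-bin : ∀ r r₁ r₂ → subtrees r ≡ cons (tree r₁) (tree r₂) →
             polish r ≡ tag r ∷ polish r₁ ++ polish r₂ → size r ≡ size r₁ + size r₂ + 1 →
             Emits r₁ → Emits r₂ → Emits r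
  emit-bin r r₁ r₂ e₁ e₂ e₃ h₁ h₂ ts rewrite e₁ | e₂ | e₃ | ++-assoc (polish r₁) (polish r₂) ts =
    runs body f-emit (_ , _ , h₂ ts , _ , _ , h₁ (polish r₂ ++ ts) , refl ,
      ≤-trans (m≤m+n _ (emitCost + emitCost)) (≤-reflexive (bound emitCost (size r₁) (size r₂))))
    where
    bound : ∀ c n₁ n₂ → c + (c * (3 * n₂) + c * (3 * n₁)) + (c + c) ≡ c * (3 * (n₁ + n₂ + 1))
    bound = solve-∀

  emit-runs : ∀ r → Emits r
  emit-runs ∅         ts = emit-leaf ∅ refl refl refl ts
  emit-runs ε         ts = emit-leaf ε refl refl refl ts
  emit-runs (sym a)   ts = emit-leaf (sym a) refl refl refl ts
  emit-runs (r₁ · r₂) ts = emit-bin (r₁ · r₂) r₁ r₂ refl refl refl (emit-runs r₁) (emit-runs r₂) ts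
  emit-runs (r₁ ⊕ r₂) ts = emit-bin (r₁ ⊕ r₂) r₁ r₂ refl refl refl (emit-runs r₁) (emit-runs r₂) ts
  emit-runs (r ⋆)     ts = runs body f-emit
    (_ , _ , emit-nil ts , _ , _ , emit-runs r ts , refl ,
      ≤-trans (m≤m+n _ emitCost) (≤-reflexive (bound emitCost (size r))))
    where
    bound : ∀ c n → c + (c + c * (3 * n)) + c ≡ c * (3 * (n + 1))
    bound = solve-∀

  dead-fits : ∀ {b} → b ≤ seqCost + rejectCost + 3 * emitCost → deadOverhead + b ≤ deadCost * (1 * 1)
  dead-fits b≤ = ≤-trans (+-monoʳ-≤ deadOverhead b≤) (≤-reflexive (sym-eq (*-identityʳ deadCost)))

  -- The copy made at a node takes time linear in its size, which fits into the gap between the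
  -- squares of the operands' sizes and the square of the node's size.
  dead-runs : ∀ r (C : Info {k}) ts →
    Computes f-dead (cons (tree r) (cons (enc C) (list ts))) (list (polish (dead r C) ++ ts))
             (deadCost * (size r * size r))
  dead-runs ∅ C ts = runs body f-dead
    (inj₂ ((λ ()) , inj₂ ((λ ()) , inj₂ ((λ ()) , inj₁ (atom , refl , dead-fits z≤n)))))
  dead-runs ε C ts = runs body f-dead
    (inj₂ ((λ ()) , inj₂ ((λ ()) , inj₂ ((λ ()) , inj₂ ((λ ()) , inj₁ (atom , refl , dead-fits z≤n))))))
  dead-runs (sym a) C ts = runs body f-dead
    (inj₂ ((λ ()) , inj₂ ((λ ()) , inj₂ ((λ ()) , inj₂ ((λ ()) , inj₂ ((λ ()) ,
      _ , _ , reject-runs C ts , refl ,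
      dead-fits (≤-trans (m≤n+m rejectCost seqCost) (m≤m+n (seqCost + rejectCost) (3 * emitCost)))))))))
  dead-runs (r₁ · r₂) C ts = runs body f-dead (inj₁ (atom , CaseCons-bit (info r₂ inhabited)
    (λ eq → _ , _ , seq-runs (info r₂) C , _ , _ , dead-runs r₂ C ts , _ , _ , emit-runs r₁ _ ,
            _ , _ , dead-runs r₁ (seq (info r₂) C) _ , trans (value eq) reassociate ,
            ≤-trans (m≤m+n _ _) (≤-reflexive
              (bound deadOverhead seqCost rejectCost emitCost (size r₁) (size r₂))))
    (λ eq → value eq ,
            ≤-trans (dead-fits z≤n) (*-monoʳ-≤ deadCost (*-mono-≤ 1≤n 1≤n)))))
    where
    alive : Regexp (Fin k)
    alive = dead r₁ (seq (info r₂) C) ⊕ r₁ · dead r₂ C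
    value : ∀ {e} → info r₂ inhabited ≡ e →
            list (polish (dead (r₁ · r₂) C) ++ ts) ≡ list (polish (if e then alive else ∅) ++ ts)
    value = cong (λ e → list (polish (if e then alive else ∅) ++ ts))
    reassociate : list (polish alive ++ ts) ≡
      list (‵⊕ ∷ polish (dead r₁ (seq (info r₂) C)) ++ ‵· ∷ polish r₁ ++ polish (dead r₂ C) ++ ts)
    reassociate = cong (cons (atom ‵⊕) ∘ list) (trans
      (++-assoc (polish (dead r₁ (seq (info r₂) C))) _ ts)
      (cong (λ us → polish (dead r₁ (seq (info r₂) C)) ++ ‵· ∷ us) (++-assoc (polish r₁) _ ts)))
    1≤n : 1 ≤ size r₁ + size r₂ + 1
    1≤n = m≤n+m 1 (size r₁ + size r₂)
    -- The summand in the second line of the equation is the slack dropped by `m≤m+n`; writing it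
    -- out turns the inequality into a polynomial identity.
    bound : ∀ N s j e n₁ n₂ → let c = N + (s + j + 3 * e) in
      N + (s + c * (n₂ * n₂) + e * (3 * n₁) + c * (n₁ * n₁)) +
        (j + 3 * e + (N + s + j) * n₁ + c * n₁ + 2 * c * n₂ + 2 * c * n₁ * n₂)
      ≡ c * ((n₁ + n₂ + 1) * (n₁ + n₂ + 1))
    bound = solve-∀
  dead-runs (r₁ ⊕ r₂) C ts = runs body f-dead (inj₂ ((λ ()) , inj₁ (atom ,
    _ , _ , dead-runs r₂ C ts , _ , _ , dead-runs r₁ C _ ,
    cong (cons (atom ‵⊕) ∘ list) (++-assoc (polish (dead r₁ C)) _ ts) ,
    ≤-trans (m≤m+n _ _) (≤-reflexive
      (bound deadOverhead (seqCost + rejectCost + 3 * emitCost) (size r₁) (size r₂))))))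
    where
    bound : ∀ N o n₁ n₂ → let c = N + o in
      N + (c * (n₂ * n₂) + c * (n₁ * n₁)) + (o + 2 * c * (n₁ + n₂ + n₁ * n₂))
      ≡ c * ((n₁ + n₂ + 1) * (n₁ + n₂ + 1))
    bound = solve-∀
  dead-runs (r ⋆) C ts = runs body f-dead (inj₂ ((λ ()) , inj₂ ((λ ()) , inj₁ (atom ,
    _ , _ , seq-runs (info (r ⋆)) C , _ , _ , dead-runs r (seq (info (r ⋆)) C) ts , _ , _ , emit-runs (r ⋆) _ ,
    cong (cons (atom ‵·) ∘ list) (++-assoc (polish (r ⋆)) _ ts) ,
    ≤-trans (m≤m+n _ _) (≤-reflexive
      (bound deadOverhead seqCost rejectCost emitCost (size r)))))))
    where
    bound : ∀ N s j e n → let c = N + (s + j + 3 * e) in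
      N + (s + c * (n * n) + e * (3 * (n + 1))) + (j + c * n + (N + s + j) * n)
      ≡ c * ((n + 1) * (n + 1))
    bound = solve-∀

  -- The whole program and its cubic bound.

  program : Program Tok
  program = record { functions = 8 ; body = body ; main = mainE }

  constant : ℕ
  constant = overhead body mainE + (parseCost + leafCost + deadCost + rejectCost)

  1≤size : (r : Regexp (Fin k)) → 1 ≤ size r
  1≤size ∅         = ≤-refl
  1≤size ε         = ≤-refl
  1≤size (sym _)   = ≤-refl
  1≤size (r₁ · r₂) = m≤n+m 1 (size r₁ + size r₂)
  1≤size (r₁ ⊕ r₂) = m≤n+m 1 (size r₁ + size r₂)
  1≤size (r ⋆)     = m≤n+m 1 (size r)

  -- Parsing is linear, writing the dead words is quadratic and the rest is constant; all of it lies
  -- below the cube because sizes are at least 1.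
  main-runs : ∀ r → ∃[ t ] program ⟨ polish r ⟩↦ polish (complement r) inTime t × t ≤ constant * size r ^ 3
  main-runs r = evaluates body mainE
    (_ , _ , subst (λ ts → Computes f-parse (list ts) (cons (tree r) nil) (parseCost * size r))
                   (++-identityʳ (polish r)) (parse-runs r []) ,
     _ , _ , leaf-ε , _ , _ , dead-runs r I-ε [] , _ , _ , reject-runs (info r) _ ,
     cong (λ ts → list (‵⊕ ∷ polish (reject (info r)) ++ ts)) (sym-eq (++-identityʳ _)) ,
     cubic (overhead body mainE) parseCost leafCost deadCost rejectCost (size r) (1≤size r))
    where
    cubic : ∀ o p l d j n → 1 ≤ n →
            o + (p * n + l + d * (n * n) + j) ≤ (o + (p + l + d + j)) * n ^ 3
    -- With the size written as a successor, every coefficient of the slack is a natural number.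
    cubic o p l d j (suc n) _ = ≤-trans (m≤m+n _ _) (≤-reflexive (expand o p l d j n))
      where
      expand : ∀ o p l d j n →
        o + (p * (1 + n) + l + d * ((1 + n) * (1 + n)) + j) +
          ((o + l + j) * (n * n * n + 3 * (n * n) + 3 * n) + p * (n * n * n + 3 * (n * n) + 2 * n)
            + d * (n * n * n + 2 * (n * n) + n))
        ≡ (o + (p + l + d + j)) * ((1 + n) * ((1 + n) * ((1 + n) * 1)))
      expand = solve-∀

theorem4p2 : (k : ℕ) →
    Σ[ P ∈ Program (Token (Fin k)) ] Σ[ c ∈ ℕ ]
    ((r : Regexp (Fin k)) → OneUnambiguous r →
    Σ[ s ∈ Regexp (Fin k) ] Σ[ t ∈ ℕ ]
    ((P ⟨ polish r ⟩↦ polish s inTime t) × (t ≤ c * size r ^ 3) × (L s ≐ ∁ (L r))))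
theorem4p2 k = program , constant , λ r 1U →
  let t , runs-in-t , t≤ = main-runs r
  in complement r , t , runs-in-t , t≤ , complement-correct r 1U
  where open Machine k
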